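{- For all integers $n,m\ge 3$, $\gamma_p(C_n\times C_m)\le 4\left\lceil\frac{n}{4}\right\rceil\left\lceil\frac{m}{4}\right\rceil$.
   Context: All graphs are finite, simple and undirected. $C_n$ denotes the cycle of order $n$ and $G\times H$ the Cartesian product of graphs. For a graph $G$ without isolated vertices, a set $D\subseteq V(G)$ is a paired dominating set if every vertex outside $D$ has a neighbour in $D$ and the induced subgraph $G[D]$ has a perfect matching; $\gamma_p(G)$ is the minimum size of a paired dominating set. -}

module Defs where

open import Data.Fin using (Fin; toℕ)
open import Data.List using (List; length)
open import Data.List.Membership.Propositional using (_∈_; _∉_)
open import Data.List.Relation.Unary.Unique.Propositional using (Unique)
open import Data.Nat using (ℕ; suc; _+_; _≤_; s≤s)
open import Data.Nat.DivMod using (_/_)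
open import Data.Nat.Properties using (1+n≢n)
open import Data.Product using (Σ; ∃-syntax; ∃!; _×_; _,_; proj₁)
open import Data.Sum using (_⊎_; inj₁; inj₂; swap)
open import Relation.Binary.PropositionalEquality using (_≡_; refl; sym; trans; cong)
open import Relation.Nullary using (¬_)

record SimpleGraph (V : Set) : Set₁ where
  infix 4 _~_
  field
    _~_      : V → V → Set
    ~-sym    : ∀ {u v} → u ~ v → v ~ u
    ~-irrefl : ∀ {v} → ¬ (v ~ v)

open SimpleGraph

induced : {V : Set} → SimpleGraph V → (D : List V) → SimpleGraph (Σ V (_∈ D))
induced G D ._~_ u v = _~_ G (proj₁ u) (proj₁ v)
induced G D .~-sym = ~-sym G
induced G D .~-irrefl = ~-irrefl G

infixr 6 _□_

_□_ : {V W : Set} → SimpleGraph V → SimpleGraph W → SimpleGraph (V × W)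
(G □ H) ._~_ (u , x) (v , y) = (u ≡ v × _~_ H x y) ⊎ (_~_ G u v × x ≡ y)
(G □ H) .~-sym (inj₁ (u≡v , x~y)) = inj₁ (sym u≡v , ~-sym H x~y)
(G □ H) .~-sym (inj₂ (u~v , x≡y)) = inj₂ (~-sym G u~v , sym x≡y)
(G □ H) .~-irrefl (inj₁ (_ , x~x)) = ~-irrefl H x~x
(G □ H) .~-irrefl (inj₂ (u~u , _)) = ~-irrefl G u~u

-- j is the successor of i in the cyclic order 0, 1, …, n - 1, 0.
Next : (n : ℕ) → Fin n → Fin n → Set
Next n i j = suc (toℕ i) ≡ toℕ j ⊎ (suc (toℕ i) ≡ n × toℕ j ≡ 0)

Next-irrefl : ∀ n → 3 ≤ n → ∀ i → ¬ Next n i i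
Next-irrefl n 3≤n i (inj₁ e) = 1+n≢n e
Next-irrefl n 3≤n i (inj₂ (e , z)) with trans (sym e) (cong suc z)
Next-irrefl n (s≤s ()) i (inj₂ (e , z)) | refl

C : (n : ℕ) → 3 ≤ n → SimpleGraph (Fin n)
C n _ ._~_ i j = Next n i j ⊎ Next n j i
C n _ .~-sym = swap
C n 3≤n .~-irrefl {v} (inj₁ e) = Next-irrefl n 3≤n v e
C n 3≤n .~-irrefl {v} (inj₂ e) = Next-irrefl n 3≤n v e

-- A perfect matching, given as a spanning subgraph M whose edges cover every
-- vertex exactly once.
record PerfectMatching {V : Set} (G : SimpleGraph V) : Set₁ where
  field
    M        : SimpleGraph V
    subgraph : ∀ {u v} → _~_ M u v → _~_ G u v
    covered  : ∀ u → ∃! _≡_ (λ v → _~_ M u v)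

-- Finite vertex sets are duplicate-free lists, so that |D| is length D.
record IsPairedDominating {V : Set} (G : SimpleGraph V) (D : List V) : Set₁ where
  field
    unique     : Unique D
    dominating : ∀ v → v ∉ D → ∃[ w ] (w ∈ D × _~_ G v w)
    paired     : PerfectMatching (induced G D)

-- IsPairedDominationNumber G k says γₚ(G) = k for a graph G on a finite
-- vertex type.  If it holds then G has no isolated vertex: each vertex has a
-- neighbour in the set below, or a partner in its matching.
record IsPairedDominationNumber {V : Set} (G : SimpleGraph V) (k : ℕ) : Set₁ where
  field
    attained : ∃[ D ] (IsPairedDominating G D × length D ≡ k)
    minimal  : ∀ D → IsPairedDominating G D → k ≤ length D

⌈_/4⌉ : ℕ → ℕ
⌈ n /4⌉ = (n + 3) / 4

{-# OPTIONS --safe #-}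
-- In C₄ₖ × C₄ₗ the edges (4a , 4b)-(4a , 4b+1) and (4a+2 , 4b+2)-(4a+2 , 4b+3)
-- have endpoints whose closed neighbourhoods cover the torus.  For general n
-- and m, with k = ⌈n/4⌉ and l = ⌈m/4⌉, the coordinates beyond the end of a cycle
-- are collapsed to 0; this keeps consecutive coordinates adjacent or equal, so
-- the images of the 2kl edges still cover, but they may overlap or degenerate.
-- A greedy argument repairs this in any graph without isolated vertices: when a
-- vertex v is to be covered and v ∉ D, either some neighbour w of v lies outside
-- D and the edge vw is added, or all of N(v) lies in D and N[v] is already covered.
--
-- The minimum γₚ exists constructively since a perfect matching of G[D] amounts to
-- an involution of the positions of D, which makes paired domination decidable.
module Submission where

open import Defs
open import Data.Fin using (Fin; zero; suc; toℕ; fromℕ<)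
open import Data.Fin.Properties using (toℕ-fromℕ<; fromℕ<-toℕ; toℕ<n) renaming (_≟_ to _≟ᶠ_; any? to anyᶠ?; all? to allᶠ?)
open import Data.List using (List; []; _∷_; _++_; length; lookup; map; cartesianProduct; upTo)
open import Data.List.Membership.Propositional using (_∈_; _∉_)
open import Data.List.Membership.Propositional.Properties using (∈-lookup; ∈-map⁺; ∈-++⁺ˡ; ∈-++⁺ʳ; ∈-cartesianProduct⁺; ∈-upTo⁺)
open import Data.List.Properties using (length-map; length-++; length-upTo)
open import Data.List.Relation.Binary.Subset.Propositional using (_⊆_)
open import Data.List.Relation.Unary.All using (All; []; _∷_)
open import Data.List.Relation.Unary.All.Properties using (¬Any⇒All¬; ++⁺; map⁺)
import Data.List.Relation.Unary.All as All
open import Data.List.Relation.Unary.AllPairs using ([]; _∷_; allPairs?)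
open import Data.List.Relation.Unary.Any using (here; there; index; any?)
open import Data.List.Relation.Unary.Unique.Propositional using (Unique)
open import Data.Nat using (ℕ; zero; suc; _+_; _*_; _≤_; _<_; z≤n; s≤s; _<?_; _≟_)
open import Data.Nat.DivMod using (_/_; _%_; m≡m%n+[m/n]*n; m%n<n; m<n*o⇒m/o<n)
open import Data.Nat.Properties using (module ≤-Reasoning; ≤-refl; ≤-trans; ≤-antisym; <-≤-trans; <-≤-connex; m≤n⇒m≤1+n; ≤-pred; ≮⇒≥; n≤1+n; +-comm; +-monoʳ-≤; +-monoˡ-≤; +-cancelˡ-≤; *-distribˡ-+; 1+n≰n)
open import Data.Nat.Tactic.RingSolver using (solve-∀)
open import Data.Product using (Σ; ∃; ∃-syntax; _×_; _,_; proj₁; proj₂)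
open import Data.Product.Properties using (≡-dec)
open import Data.Sum using (_⊎_; inj₁; inj₂; [_,_]′)
open import Data.Vec as Vec using (Vec; []; _∷_; toList; fromList)
open import Data.Vec.Properties using (toList∘fromList; length-toList; lookup∘tabulate)
open import Function using (_∘_; id)
open import Relation.Binary using (DecidableEquality)
import Relation.Binary as B
open import Relation.Binary.PropositionalEquality using (_≡_; refl; sym; trans; cong; cong₂; subst)
open import Relation.Nullary using (¬_; Dec; yes; no; contradiction; ¬?; map′; _×-dec_; _⊎-dec_; _→-dec_)
open import Relation.Nullary.Decidable using (decidable-stable)
open import Relation.Unary using (Decidable)

-- Exhaustive search and least witnesses.

Exhaustible : Set → Set₁
Exhaustible A = {P : A → Set} → Decidable P → Dec (∃ P)

×-exhaustible : {A B : Set} → Exhaustible A → Exhaustible B → Exhaustible (A × B)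
×-exhaustible ea eb P? =
  map′ (λ { (x , y , p) → (x , y) , p }) (λ { ((x , y) , p) → x , y , p })
       (ea λ x → eb λ y → P? (x , y))

Vec-exhaustible : {A : Set} → Exhaustible A → ∀ k → Exhaustible (Vec A k)
Vec-exhaustible ea zero P? =
  map′ (λ p → [] , p) (λ { ([] , p) → p }) (P? [])
Vec-exhaustible ea (suc k) P? =
  map′ (λ { (x , xs , p) → x ∷ xs , p }) (λ { (x ∷ xs , p) → x , xs , p })
       (ea λ x → Vec-exhaustible ea k λ xs → P? (x ∷ xs))

universal? : {A : Set} → Exhaustible A → {P : A → Set} → Decidable P → Dec (∀ x → P x)
universal? ea P? =
  map′ (λ ¬∃ x → decidable-stable (P? x) λ ¬p → ¬∃ (x , ¬p))
       (λ { ∀p (x , ¬p) → ¬p (∀p x) })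
       (¬? (ea (¬? ∘ P?)))

least : {P : ℕ → Set} → Decidable P → ∀ k → P k → ∃[ m ] (P m × (∀ j → P j → m ≤ j))
least P? k pk with P? 0
least P? k       pk | yes p0 = 0 , p0 , λ _ _ → z≤n
least P? zero    pk | no ¬p0 = contradiction pk ¬p0
least P? (suc k) pk | no ¬p0 with least (P? ∘ suc) k pk
... | m , pm , min = suc m , pm , λ
  { zero    p → contradiction p ¬p0
  ; (suc j) p → s≤s (min j p) }

-- Positions and lengths of lists.

index-∈-lookup : {A : Set} (xs : List A) (i : Fin (length xs)) → index (∈-lookup {xs = xs} i) ≡ i
index-∈-lookup (x ∷ xs) zero    = refl
index-∈-lookup (x ∷ xs) (suc i) = cong suc (index-∈-lookup xs i)

-- A membership proof carries the same information as a position, so vertices of `induced G D` can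
-- be traded for elements of `Fin (length D)`.
∈-lookup-index : {A : Set} {x : A} {xs : List A} (p : x ∈ xs) →
  _≡_ {A = Σ A (_∈ xs)} (lookup xs (index p) , ∈-lookup (index p)) (x , p)
∈-lookup-index (here refl) = refl
∈-lookup-index (there p)   = cong (λ (x , q) → x , there q) (∈-lookup-index p)

length-cartesianProduct : {A B : Set} (xs : List A) (ys : List B) →
  length (cartesianProduct xs ys) ≡ length xs * length ys
length-cartesianProduct []       ys = refl
length-cartesianProduct (x ∷ xs) ys =
  trans (length-++ (map (x ,_) ys))
        (cong₂ _+_ (length-map (x ,_) ys) (length-cartesianProduct xs ys))

-- Perfect matchings as involutions of positions.

module Pairings {V : Set} (G : SimpleGraph V) where
  open SimpleGraph G

  -- The adjacency condition rules out fixed points, so `f` splits the positions into adjacent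
  -- pairs.
  IsPairing : (D : List V) → (Fin (length D) → Fin (length D)) → Set
  IsPairing D f = ∀ i → f (f i) ≡ i × lookup D i ~ lookup D (f i)

  Pairing : List V → Set
  Pairing D = ∃ (IsPairing D)

  Pairing⇒PerfectMatching : ∀ {D} → Pairing D → PerfectMatching (induced G D)
  Pairing⇒PerfectMatching {D} (f , isPairing) = record
    { M        = record
      { _~_      = λ (_ , p) (_ , q) → f (index p) ≡ index q
      ; ~-sym    = λ {(_ , p)} e → trans (cong f (sym e)) (proj₁ (isPairing (index p)))
      ; ~-irrefl = λ {(_ , p)} e →
          ~-irrefl (subst (λ i → lookup D (index p) ~ lookup D i) e (proj₂ (isPairing (index p))))
      }
    ; subgraph = λ {(_ , p)} {(_ , q)} e →
        subst (_ ~_) (cong proj₁ (∈-lookup-index q))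
          (subst (_~ _) (cong proj₁ (∈-lookup-index p))
            (subst (λ i → lookup D (index p) ~ lookup D i) e (proj₂ (isPairing (index p)))))
    ; covered  = λ (_ , p) →
        (lookup D (f (index p)) , ∈-lookup (f (index p))) ,
        sym (index-∈-lookup D (f (index p))) ,
        λ {(_ , q)} e → trans (cong (λ i → lookup D i , ∈-lookup i) e) (∈-lookup-index q)
    }

  PerfectMatching⇒Pairing : ∀ {D} → PerfectMatching (induced G D) → Pairing D
  PerfectMatching⇒Pairing {D} matching = f , λ i → involutive i , adjacent i
    where
    open PerfectMatching matching
    open SimpleGraph M renaming (_~_ to _↔_; ~-sym to ↔-sym) using ()

    vertex : Fin (length D) → Σ V (_∈ D)
    vertex i = lookup D i , ∈-lookup i

    f : Fin (length D) → Fin (length D)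
    f i = index (proj₂ (proj₁ (covered (vertex i))))

    vertex-f : ∀ i → vertex (f i) ≡ proj₁ (covered (vertex i))
    vertex-f i = ∈-lookup-index (proj₂ (proj₁ (covered (vertex i))))

    matched : ∀ i → vertex i ↔ vertex (f i)
    matched i = subst (vertex i ↔_) (sym (vertex-f i)) (proj₁ (proj₂ (covered (vertex i))))

    involutive : ∀ i → f (f i) ≡ i
    involutive i =
      -- By symmetry of `M`, `vertex i` is a partner of `vertex (f i)`; uniqueness makes it the
      -- partner that defines `f (f i)`.
      trans (cong (λ (_ , p) → index p)
              (proj₂ (proj₂ (covered (vertex (f i)))) (↔-sym (matched i))))
            (index-∈-lookup D i)

    adjacent : ∀ i → lookup D i ~ lookup D (f i)
    adjacent i = subgraph (matched i)

  Pairing-∷∷ : ∀ {D u v} → u ~ v → Pairing D → Pairing (u ∷ v ∷ D)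
  Pairing-∷∷ {D} {u} {v} u~v (f , isPairing) = g , isPairing′
    where
    g : Fin (length (u ∷ v ∷ D)) → Fin (length (u ∷ v ∷ D))
    g zero          = suc zero
    g (suc zero)    = zero
    g (suc (suc i)) = suc (suc (f i))

    isPairing′ : IsPairing (u ∷ v ∷ D) g
    isPairing′ zero          = refl , u~v
    isPairing′ (suc zero)    = refl , ~-sym u~v
    isPairing′ (suc (suc i)) = cong (Fin.suc ∘ Fin.suc) (proj₁ (isPairing i)) , proj₂ (isPairing i)

  -- The search runs over tables of values: a function agrees with its tabulation pointwise, and
  -- `IsPairing` depends on nothing more.
  pairing? : B.Decidable _~_ → Decidable Pairing
  pairing? _~?_ D =
    map′ (λ (fs , isPairing) → Vec.lookup fs , isPairing)
         (λ (f , isPairing) → Vec.tabulate f , λ i → tabulated f isPairing i)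
         (Vec-exhaustible anyᶠ? (length D) λ fs → allᶠ? λ i →
           (Vec.lookup fs (Vec.lookup fs i) ≟ᶠ i) ×-dec
           (lookup D i ~? lookup D (Vec.lookup fs i)))
    where
    tabulated : ∀ f → IsPairing D f → IsPairing D (Vec.lookup (Vec.tabulate f))
    tabulated f isPairing i
      rewrite lookup∘tabulate f i | lookup∘tabulate f (f i) = isPairing i

-- Decidability of paired domination and existence of γₚ.

module FiniteGraph {V : Set} (G : SimpleGraph V) (_≟ⱽ_ : DecidableEquality V)
  (exhaustible : Exhaustible V) (_~?_ : B.Decidable (SimpleGraph._~_ G)) where
  open SimpleGraph G
  open Pairings G

  _∈?_ : B.Decidable {A = V} _∈_
  v ∈? D = any? (v ≟ⱽ_) D

  -- `IsPairedDominating` lives in `Set₁`, since a matching there is an arbitrary relation. This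
  -- equivalent form stays in `Set` and is open to exhaustive search.
  record PairedDominating (D : List V) : Set where
    field
      unique     : Unique D
      dominating : ∀ v → v ∉ D → ∃[ w ] (w ∈ D × v ~ w)
      pairing    : Pairing D

  PairedDominating⇒IsPairedDominating : ∀ {D} → PairedDominating D → IsPairedDominating G D
  PairedDominating⇒IsPairedDominating pd = record
    { unique = unique ; dominating = dominating ; paired = Pairing⇒PerfectMatching pairing }
    where open PairedDominating pd

  IsPairedDominating⇒PairedDominating : ∀ {D} → IsPairedDominating G D → PairedDominating D
  IsPairedDominating⇒PairedDominating ipd = record
    { unique = unique ; dominating = dominating ; pairing = PerfectMatching⇒Pairing paired }
    where open IsPairedDominating ipd

  pairedDominating? : Decidable PairedDominating
  pairedDominating? D =
    map′ (λ (u , d , p) → record { unique = u ; dominating = d ; pairing = p })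
         (λ pd → PairedDominating.unique pd , PairedDominating.dominating pd , PairedDominating.pairing pd)
         (allPairs? (λ u v → ¬? (u ≟ⱽ v)) D ×-dec
          universal? exhaustible (λ v → ¬? (v ∈? D) →-dec
            exhaustible λ w → (w ∈? D) ×-dec (v ~? w)) ×-dec
          pairing? _~?_ D)

  HasSize : ℕ → Set
  HasSize k = ∃[ D ] (PairedDominating D × length D ≡ k)

  hasSize? : Decidable HasSize
  hasSize? k =
    map′ (λ (xs , pd) → toList xs , pd , length-toList xs)
         (λ { (D , pd , refl) → fromList D , subst PairedDominating (sym (toList∘fromList D)) pd })
         (Vec-exhaustible exhaustible k (pairedDominating? ∘ toList))

  dominationNumber≤ : ∀ {D} → PairedDominating D → ∃[ γ ] (IsPairedDominationNumber G γ × γ ≤ length D)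
  dominationNumber≤ {D} pd with least hasSize? (length D) (D , pd , refl)
  ... | γ , (D₀ , pd₀ , ∣D₀∣≡γ) , min =
    γ ,
    record
      { attained = D₀ , PairedDominating⇒IsPairedDominating pd₀ , ∣D₀∣≡γ
      ; minimal  = λ D′ ipd → min (length D′) (D′ , IsPairedDominating⇒PairedDominating ipd , refl)
      } ,
    min (length D) (D , pd , refl)

  -- Greedy saturation of a list of edges.

  infix 4 _≃_

  _≃_ : V → V → Set
  u ≃ v = u ≡ v ⊎ u ~ v

  Dominated : List V → V → Set
  Dominated D v = ∃[ w ] (w ∈ D × v ≃ w)

  -- The greedy invariant: the closed neighbourhood of `v` is dominated, whether or not `v` itself
  -- was chosen.
  Covers : List V → V → Set
  Covers D v = ∀ x → x ≃ v → Dominated D x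

  ∈⇒Covers : ∀ {D v} → v ∈ D → Covers D v
  ∈⇒Covers v∈D _ x≃v = _ , v∈D , x≃v

  Covers-⊆ : ∀ {D D′ v} → D ⊆ D′ → Covers D v → Covers D′ v
  Covers-⊆ D⊆D′ c x x≃v with c x x≃v
  ... | w , w∈D , x≃w = w , D⊆D′ w∈D , x≃w

  Matched : List V → Set
  Matched D = Unique D × Pairing D

  Matched-∷∷ : ∀ {D u v} → u ~ v → u ∉ D → v ∉ D → Matched D → Matched (u ∷ v ∷ D)
  Matched-∷∷ u~v u∉D v∉D (unique , pairing) =
    ((λ { refl → ~-irrefl u~v }) ∷ ¬Any⇒All¬ _ u∉D) ∷ ¬Any⇒All¬ _ v∉D ∷ unique ,
    Pairing-∷∷ u~v pairing

  record Extension (D : List V) (vs : List V) : Set where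
    field
      set     : List V
      matched : Matched set
      size    : length set ≤ 2 + length D
      ⊇       : D ⊆ set
      covers  : All (Covers set) vs

  module _ (neighbour : ∀ v → ∃ (v ~_)) where

    ext-vertex : ∀ {D} → Matched D → ∀ v → Extension D (v ∷ [])
    ext-vertex {D} md v with v ∈? D
    ... | yes v∈D = record
      { set = D ; matched = md ; size = ≤-trans (n≤1+n _) (n≤1+n _) ; ⊇ = id
      ; covers = ∈⇒Covers v∈D ∷ [] }
    ... | no v∉D with exhaustible (λ w → (v ~? w) ×-dec ¬? (w ∈? D))
    ... | yes (w , v~w , w∉D) = record
      { set = v ∷ w ∷ D ; matched = Matched-∷∷ v~w v∉D w∉D md ; size = ≤-refl
      ; ⊇ = there ∘ there ; covers = ∈⇒Covers (here refl) ∷ [] }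
    ... | no ¬outside = record
      { set = D ; matched = md ; size = ≤-trans (n≤1+n _) (n≤1+n _) ; ⊇ = id
      ; covers = covers ∷ [] }
      where
      neighbour∈D : ∀ {w} → v ~ w → w ∈ D
      neighbour∈D {w} v~w = decidable-stable (w ∈? D) λ w∉D → ¬outside (w , v~w , w∉D)

      covers : Covers D v
      -- All neighbours of `v` lie in `D`: each dominates itself, and one of them dominates `v`, as
      -- `v` is not isolated.
      covers _ (inj₁ refl) with neighbour v
      ... | w , v~w = w , neighbour∈D v~w , inj₂ v~w
      covers _ (inj₂ x~v) = _ , neighbour∈D (~-sym x~v) , inj₁ refl

    -- Two new vertices always suffice. An endpoint already in `D` is covered, leaving one vertex to
    -- treat; a degenerate edge is one vertex; a genuine edge outside `D` is added whole.
    ext-edge : ∀ {D} → Matched D → ∀ {u v} → u ≃ v → Extension D (u ∷ v ∷ [])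
    ext-edge {D} md {u} {v} u≃v with u ∈? D | v ∈? D
    ... | yes u∈D | _ = record
      { set = set ; matched = matched ; size = size ; ⊇ = ⊇ ; covers = ∈⇒Covers (⊇ u∈D) ∷ covers }
      where open Extension (ext-vertex md v)
    ... | no u∉D | yes v∈D = record
      { set = set ; matched = matched ; size = size ; ⊇ = ⊇
      ; covers = All.head covers ∷ ∈⇒Covers (⊇ v∈D) ∷ [] }
      where open Extension (ext-vertex md u)
    ext-edge {D} md {u} {v} (inj₂ u~v) | no u∉D | no v∉D = record
      { set = u ∷ v ∷ D ; matched = Matched-∷∷ u~v u∉D v∉D md ; size = ≤-refl
      ; ⊇ = there ∘ there ; covers = ∈⇒Covers (here refl) ∷ ∈⇒Covers (there (here refl)) ∷ [] }
    ext-edge {D} md {u} {.u} (inj₁ refl) | no u∉D | no v∉D = record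
      { set = set ; matched = matched ; size = size ; ⊇ = ⊇
      ; covers = All.head covers ∷ All.head covers ∷ [] }
      where open Extension (ext-vertex md u)

    saturate : (E : List (V × V)) → All (λ (u , v) → u ≃ v) E →
      ∃[ D ] (Matched D × length D ≤ 2 * length E ×
              All (λ (u , v) → Covers D u × Covers D v) E)
    saturate [] [] = [] , ([] , (λ ()) , (λ ())) , z≤n , []
    saturate ((u , v) ∷ E) (u≃v ∷ E≃) with saturate E E≃
    ... | D , md , ∣D∣≤ , coverE with ext-edge md u≃v
    ... | record { set = D′ ; matched = md′ ; size = ∣D′∣≤ ; ⊇ = D⊆D′ ; covers = cu ∷ cv ∷ [] } =
      D′ , md′ , size , (cu , cv) ∷ All.map (λ (cu , cv) → Covers-⊆ D⊆D′ cu , Covers-⊆ D⊆D′ cv) coverE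
      where
      open ≤-Reasoning
      size : length D′ ≤ 2 * suc (length E)
      size = begin
        length D′            ≤⟨ ∣D′∣≤ ⟩
        2 + length D         ≤⟨ +-monoʳ-≤ 2 ∣D∣≤ ⟩
        2 + 2 * length E     ≡⟨ *-distribˡ-+ 2 1 (length E) ⟨
        2 * suc (length E)   ∎

    -- The greedy set is not known in advance, so the domination hypothesis ranges over every `D`
    -- covering the ends of the pairs in `E`.
    saturation-bound : (E : List (V × V)) → All (λ (u , v) → u ≃ v) E →
      (∀ {D} → All (λ (u , v) → Covers D u × Covers D v) E → ∀ v → Dominated D v) →
      ∃[ γ ] (IsPairedDominationNumber G γ × γ ≤ 2 * length E)
    saturation-bound E E≃ dominates with saturate E E≃
    ... | D , (unique , pairing) , ∣D∣≤ , coverE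
      with dominationNumber≤ {D} (record { unique = unique ; dominating = dominating ; pairing = pairing })
      where
      dominating : ∀ v → v ∉ D → ∃[ w ] (w ∈ D × v ~ w)
      dominating v v∉D with dominates coverE v
      ... | w , w∈D , inj₁ refl = contradiction w∈D v∉D
      ... | w , w∈D , inj₂ v~w  = w , w∈D , v~w
    ... | γ , isγ , γ≤ = γ , isγ , ≤-trans γ≤ ∣D∣≤

-- Collapsed cycle coordinates in blocks of four.

module Cycle (n : ℕ) (3≤n : 3 ≤ n) where
  open SimpleGraph (C n 3≤n)

  k : ℕ
  k = ⌈ n /4⌉

  -- Dividing `n + 3` by 4 leaves a remainder of at most 3, which cancels against the added 3.
  n≤k*4 : n ≤ k * 4
  n≤k*4 = +-cancelˡ-≤ 3 n (k * 4) (begin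
    3 + n                     ≡⟨ +-comm 3 n ⟩
    n + 3                     ≡⟨ m≡m%n+[m/n]*n (n + 3) 4 ⟩
    (n + 3) % 4 + k * 4       ≤⟨ +-monoˡ-≤ (k * 4) (≤-pred (m%n<n (n + 3) 4)) ⟩
    3 + k * 4                 ∎)
    where open ≤-Reasoning

  0<n : 0 < n
  0<n = ≤-trans (s≤s z≤n) 3≤n

  next? : B.Decidable (Next n)
  next? i j = (suc (toℕ i) ≟ toℕ j) ⊎-dec ((suc (toℕ i) ≟ n) ×-dec (toℕ j ≟ 0))

  _~?_ : B.Decidable _~_
  i ~? j = next? i j ⊎-dec next? j i

  -- Not reduction modulo `n`: every index from `n` on goes to 0.
  wrap : ℕ → Fin n
  wrap x with x <? n
  ... | yes x<n = fromℕ< x<n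
  ... | no  _   = fromℕ< 0<n

  wrap-toℕ : ∀ i → wrap (toℕ i) ≡ i
  wrap-toℕ i with toℕ i <? n
  ... | yes i<n = fromℕ<-toℕ i i<n
  ... | no  i≮n = contradiction (toℕ<n i) i≮n

  wrap-≥ : ∀ {x} → n ≤ x → wrap x ≡ wrap 0
  wrap-≥ {x} n≤x with x <? n | 0 <? n
  ... | yes x<n | _       = contradiction (≤-trans x<n n≤x) 1+n≰n
  ... | no _    | yes _   = refl
  ... | no _    | no 0≮n  = contradiction 0<n 0≮n

  wrap-Next : ∀ {x} → x < n → Next n (wrap x) (wrap (suc x))
  wrap-Next {x} x<n with x <? n | suc x <? n
  ... | no x≮n | _           = contradiction x<n x≮n
  ... | yes p  | yes sx<n    = inj₁ (trans (cong suc (toℕ-fromℕ< p)) (sym (toℕ-fromℕ< sx<n)))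
  -- Here `suc x` equals `n`, and the pair is the closing edge of the cycle.
  ... | yes p  | no sx≮n     = inj₂ (trans (cong suc (toℕ-fromℕ< p)) (≤-antisym p (≮⇒≥ sx≮n)) , toℕ-fromℕ< 0<n)

  infix 4 _≃_

  _≃_ : Fin n → Fin n → Set
  i ≃ j = i ≡ j ⊎ i ~ j

  ≃-sym : ∀ {i j} → i ≃ j → j ≃ i
  ≃-sym (inj₁ e) = inj₁ (sym e)
  ≃-sym (inj₂ a) = inj₂ (~-sym a)

  -- Below `n` this is an edge of the cycle; from `n` on both sides have collapsed to 0.
  wrap-≃ : ∀ x → wrap x ≃ wrap (suc x)
  wrap-≃ x = [ inj₂ ∘ inj₁ ∘ wrap-Next
             , (λ n≤x → inj₁ (trans (wrap-≥ n≤x) (sym (wrap-≥ (m≤n⇒m≤1+n n≤x)))))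
             ]′ (<-≤-connex x n)

  neighbour : ∀ i → ∃ (i ~_)
  neighbour i = wrap (suc (toℕ i)) , subst (_~ wrap (suc (toℕ i))) (wrap-toℕ i) (inj₁ (wrap-Next (toℕ<n i)))

  -- Weaker than congruence to `r` modulo 4: through collapsed indices, vertex 0 can be `At` several
  -- residues.
  At : ℕ → Fin n → Set
  At r i = ∃[ a ] (a < k × i ≡ wrap (r + a * 4))

  Near : ℕ → Fin n → Set
  Near r i = ∃[ a ] (a < k × i ≃ wrap (r + a * 4))

  data Residue (i : Fin n) : Set where
    at₀ : At 0 i → Residue i
    at₁ : At 1 i → Residue i
    at₂ : At 2 i → Residue i
    at₃ : At 3 i → Residue i

  residue : ∀ i → Residue i
  residue i = go (toℕ i % 4) (m%n<n (toℕ i) 4)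
    (toℕ i / 4 , m<n*o⇒m/o<n (<-≤-trans (toℕ<n i) n≤k*4) ,
     trans (sym (wrap-toℕ i)) (cong wrap (m≡m%n+[m/n]*n (toℕ i) 4)))
    where
    go : ∀ r → r < 4 → At r i → Residue i
    go 0 _ = at₀
    go 1 _ = at₁
    go 2 _ = at₂
    go 3 _ = at₃
    go (suc (suc (suc (suc _)))) (s≤s (s≤s (s≤s (s≤s ()))))

  At⇒Near : ∀ {r i} → At r i → Near r i
  At⇒Near (a , a<k , i≡) = a , a<k , inj₁ i≡

  At⇒Near-suc : ∀ {r i} → At r i → Near (suc r) i
  At⇒Near-suc (a , a<k , refl) = a , a<k , wrap-≃ _

  At-suc⇒Near : ∀ {r i} → At (suc r) i → Near r i
  At-suc⇒Near (a , a<k , refl) = a , a<k , ≃-sym (wrap-≃ _)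

  -- After the last block comes index `k * 4`, which is at least `n` and so collapses to the 0 of
  -- the first block.
  At-3⇒Near-0 : ∀ {i} → At 3 i → Near 0 i
  At-3⇒Near-0 (a , a<k , refl) with suc a <? k
  ... | yes sa<k = suc a , sa<k , wrap-≃ _
  ... | no sa≮k  = 0 , ≤-trans (s≤s z≤n) a<k , subst (wrap (3 + a * 4) ≃_) (wrap-≥ n≤) (wrap-≃ _)
    where
    n≤ : n ≤ suc a * 4
    n≤ = subst (λ x → n ≤ x * 4) (≤-antisym (≮⇒≥ sa≮k) a<k) n≤k*4

  At-0⇒Near-3 : ∀ {i} → At 0 i → Near 3 i
  At-0⇒Near-3 (suc a , sa<k , refl) = a , ≤-trans (n≤1+n _) sa<k , ≃-sym (wrap-≃ _)
  At-0⇒Near-3 (zero , 0<k , refl) = last k 0<k ≤-refl n≤k*4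
    where
    -- The quotient `k` cannot be matched against `suc a`, so it is generalised to `l`; the witness
    -- is the last block.
    last : ∀ l → 0 < l → l ≤ k → n ≤ l * 4 → Near 3 (wrap 0)
    last (suc a) _ a<k n≤ = a , a<k , ≃-sym (subst (wrap (3 + a * 4) ≃_) (wrap-≥ n≤) (wrap-≃ _))

  -- Positions 0 and 1 of a block reach residues 3, 0, 1, 2 in cyclic order, a full period.
  -- Positions 2 and 3 do the same, shifted by two.
  Near-0⊎1 : ∀ j → Near 0 j ⊎ Near 1 j
  Near-0⊎1 j with residue j
  ... | at₀ at = inj₁ (At⇒Near at)
  ... | at₁ at = inj₂ (At⇒Near at)
  ... | at₂ at = inj₂ (At-suc⇒Near at)
  ... | at₃ at = inj₁ (At-3⇒Near-0 at)

  Near-2⊎3 : ∀ j → Near 2 j ⊎ Near 3 j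
  Near-2⊎3 j with residue j
  ... | at₀ at = inj₂ (At-0⇒Near-3 at)
  ... | at₁ at = inj₁ (At⇒Near-suc at)
  ... | at₂ at = inj₁ (At⇒Near at)
  ... | at₃ at = inj₂ (At⇒Near at)

-- The covering edges of the torus.

module Torus (n m : ℕ) (3≤n : 3 ≤ n) (3≤m : 3 ≤ m) where
  module R = Cycle n 3≤n
  module S = Cycle m 3≤m

  T : SimpleGraph (Fin n × Fin m)
  T = C n 3≤n □ C m 3≤m

  open SimpleGraph T

  _≟ⱽ_ : DecidableEquality (Fin n × Fin m)
  _≟ⱽ_ = ≡-dec _≟ᶠ_ _≟ᶠ_

  _~?_ : B.Decidable _~_
  (u , x) ~? (v , y) = ((u ≟ᶠ v) ×-dec (x S.~? y)) ⊎-dec ((u R.~? v) ×-dec (x ≟ᶠ y))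

  open FiniteGraph T _≟ⱽ_ (×-exhaustible anyᶠ? anyᶠ?) _~?_

  ≃-row : ∀ {i x y} → x S.≃ y → (i , x) ≃ (i , y)
  ≃-row (inj₁ refl) = inj₁ refl
  ≃-row (inj₂ x~y)  = inj₂ (inj₁ (refl , x~y))

  ≃-column : ∀ {u v j} → u R.≃ v → (u , j) ≃ (v , j)
  ≃-column (inj₁ refl) = inj₁ refl
  ≃-column (inj₂ u~v)  = inj₂ (inj₂ (u~v , refl))

  neighbour : ∀ v → ∃ (v ~_)
  neighbour (i , j) with S.neighbour j
  ... | y , j~y = (i , y) , inj₁ (refl , j~y)

  point : ℕ → ℕ → ℕ × ℕ → Fin n × Fin m
  point r s (a , b) = R.wrap (r + a * 4) , S.wrap (s + b * 4)

  blocks : List (ℕ × ℕ)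
  blocks = cartesianProduct (upTo R.k) (upTo S.k)

  -- One parameter serves as both row and first column residue, since the edges used start at (0, 0)
  -- and (2, 2) in each block.
  edge : ℕ → ℕ × ℕ → (Fin n × Fin m) × (Fin n × Fin m)
  edge r ab = point r r ab , point r (suc r) ab

  edges : List ((Fin n × Fin m) × (Fin n × Fin m))
  edges = map (edge 0) blocks ++ map (edge 2) blocks

  edges-≃ : All (λ (u , v) → u ≃ v) edges
  edges-≃ = ++⁺ (edge-≃ 0) (edge-≃ 2)
    where
    edge-≃ : ∀ r → All (λ (u , v) → u ≃ v) (map (edge r) blocks)
    edge-≃ r = map⁺ (All.universal (λ _ → ≃-row (S.wrap-≃ _)) blocks)

  length-edges : 2 * length edges ≡ 4 * R.k * S.k
  length-edges = trans (cong (2 *_) (trans (length-++ (map (edge 0) blocks))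
                   (cong₂ _+_ (size (edge 0)) (size (edge 2))))) (arith R.k S.k)
    where
    size : ∀ {A : Set} (f : ℕ × ℕ → A) → length (map f blocks) ≡ R.k * S.k
    size f = trans (length-map f blocks) (trans (length-cartesianProduct (upTo R.k) (upTo S.k))
               (cong₂ _*_ (length-upTo R.k) (length-upTo S.k)))
    arith : ∀ k l → 2 * (k * l + k * l) ≡ 4 * k * l
    arith = solve-∀

  module _ {D : List (Fin n × Fin m)} (covered : All (λ (u , v) → Covers D u × Covers D v) edges) where

    Covered : ℕ → ℕ → Set
    Covered r s = ∀ {a b} → a < R.k → b < S.k → Covers D (point r s (a , b))

    block∈ : ∀ {a b} → a < R.k → b < S.k → (a , b) ∈ blocks
    block∈ a<k b<l = ∈-cartesianProduct⁺ (∈-upTo⁺ a<k) (∈-upTo⁺ b<l)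

    covered₀₀ : Covered 0 0
    covered₀₀ a<k b<l = proj₁ (All.lookup covered (∈-++⁺ˡ (∈-map⁺ (edge 0) (block∈ a<k b<l))))

    covered₀₁ : Covered 0 1
    covered₀₁ a<k b<l = proj₂ (All.lookup covered (∈-++⁺ˡ (∈-map⁺ (edge 0) (block∈ a<k b<l))))

    covered₂₂ : Covered 2 2
    covered₂₂ a<k b<l = proj₁ (All.lookup covered (∈-++⁺ʳ (map (edge 0) blocks) (∈-map⁺ (edge 2) (block∈ a<k b<l))))

    covered₂₃ : Covered 2 3
    covered₂₃ a<k b<l = proj₂ (All.lookup covered (∈-++⁺ʳ (map (edge 0) blocks) (∈-map⁺ (edge 2) (block∈ a<k b<l))))

    along-row : ∀ {r s i j} → Covered r s → R.At r i → S.Near s j → Dominated D (i , j)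
    along-row c (a , a<k , refl) (b , b<l , j≃) = c a<k b<l _ (≃-row j≃)

    along-column : ∀ {r s i j} → Covered r s → R.Near r i → S.At s j → Dominated D (i , j)
    along-column c (a , a<k , i≃) (b , b<l , refl) = c a<k b<l _ (≃-column i≃)

    row₀ : ∀ {i} → R.At 0 i → ∀ j → Dominated D (i , j)
    row₀ at j = [ along-row covered₀₀ at , along-row covered₀₁ at ]′ (S.Near-0⊎1 j)

    row₂ : ∀ {i} → R.At 2 i → ∀ j → Dominated D (i , j)
    row₂ at j = [ along-row covered₂₂ at , along-row covered₂₃ at ]′ (S.Near-2⊎3 j)

    -- Rows of residue 1 or 3 lie between rows of residue 0 and 2, whose edges occupy columns 0, 1
    -- and 2, 3; vertical neighbours thus serve every column.
    odd-row : ∀ {i} → R.Near 0 i → R.Near 2 i → ∀ j → Dominated D (i , j)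
    odd-row near₀ near₂ j with S.residue j
    ... | S.at₀ at = along-column covered₀₀ near₀ at
    ... | S.at₁ at = along-column covered₀₁ near₀ at
    ... | S.at₂ at = along-column covered₂₂ near₂ at
    ... | S.at₃ at = along-column covered₂₃ near₂ at

    dominates : ∀ v → Dominated D v
    dominates (i , j) with R.residue i
    ... | R.at₀ at = row₀ at j
    ... | R.at₁ at = odd-row (R.At-suc⇒Near at) (R.At⇒Near-suc at) j
    ... | R.at₂ at = row₂ at j
    ... | R.at₃ at = odd-row (R.At-3⇒Near-0 at) (R.At-suc⇒Near at) j

  bound : ∃[ γ ] (IsPairedDominationNumber T γ × γ ≤ 4 * R.k * S.k)
  bound = subst (λ b → ∃[ γ ] (IsPairedDominationNumber T γ × γ ≤ b)) length-edges
            (saturation-bound neighbour edges edges-≃ dominates)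

theorem5p1 : (n m : ℕ) (3≤n : 3 ≤ n) (3≤m : 3 ≤ m) →
    ∃[ γ ] (IsPairedDominationNumber (C n 3≤n □ C m 3≤m) γ × γ ≤ 4 * ⌈ n /4⌉ * ⌈ m /4⌉)
theorem5p1 = Torus.bound
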